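{- Let $N\ge 1$ be an integer, and let $\psi:\mathbb{Q}[x_0,\ldots,x_N]\to\mathbb{Q}[x_0,\ldots,x_N]$ be a $(\mathcal{D},\mathcal{D}_{\mathcal{K}_1})$-intertwining map, and suppose that it has the form $$\psi(x_0)=x_0,\qquad \psi(x_n)=\sum_{i=1}^n T(n,i)\,x_i\quad(1\le n\le N).$$ Then the numbers $T(n,i)$ have the following explicit form: $$T(n,i)=\sum_{j=i}^n(-1)^{j-i}\,2^{n-j}\,j!\,S(n,j)\binom{j-1}{i-1},$$ where $S(n,j)$ are the Stirling numbers of the second kind.
   Context: A derivation of $\mathbb{Q}[x_0,\ldots,x_N]$ is a $\mathbb{Q}$-linear map satisfying the Leibniz rule; it is determined by its values on the variables. The basic Weitzenböck derivation is $\mathcal{D}=x_0\frac{\partial}{\partial x_1}+2x_1\frac{\partial}{\partial x_2}+\cdots+N x_{N-1}\frac{\partial}{\partial x_N}$, i.e. $\mathcal{D}(x_0)=0$ and $\mathcal{D}(x_n)=n\,x_{n-1}$ for $1\le n\le N$. The first Kravchuk derivation $\mathcal{D}_{\mathcal{K}_1}$ is the derivation with $$\mathcal{D}_{\mathcal{K}_1}(x_0)=0,\qquad \mathcal{D}_{\mathcal{K}_1}(x_n)=\sum_{i=1}^{n}\frac{1-(-1)^i}{2i}\,x_{n-i}\quad(1\le n\le N).$$ A $(\mathcal{D},\mathcal{D}_{\mathcal{K}_1})$-intertwining map is a multiplicative linear map $\psi$ with $\psi\,\mathcal{D}=\mathcal{D}_{\mathcal{K}_1}\psi$. The coefficients $T(n,i)$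 are those with $1\le i\le n\le N$. -}

module Defs where

open import Algebra.Bundles using (CommutativeRing)
open import Algebra.Module.Bundles using (LeftModule)
open import Algebra.Module.Morphism.Structures using (module LeftModuleMorphisms)
import Algebra.Properties.AbelianGroup as AbelianGroupProperties
import Algebra.Properties.CommutativeSemigroup as CommutativeSemigroupProperties
import Algebra.Properties.Semiring.Sum as SemiringSum
open import Data.Bool.Base using (if_then_else_)
open import Data.Fin.Base using (Fin; zero; suc; toℕ; inject₁; fromℕ<)
open import Data.Fin.Properties using (_≟_; toℕ<n; suc-injective)
open import Data.Integer.Base as ℤ using (1ℤ; -1ℤ)
open import Data.Nat.Base as ℕ using (ℕ; zero; suc; _∸_; s≤s)
import Data.Nat.Properties as ℕ
open import Data.Product.Base using (_,_)
open import Data.Rational.Base as ℚ using (ℚ; 0ℚ; 1ℚ)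
import Data.Rational.Properties as ℚ
open import Function.Base using (_∘_)
open import Level using (0ℓ)
open import Relation.Binary.PropositionalEquality as ≡ using (_≡_; _≢_)
import Relation.Binary.Reasoning.Setoid as SetoidReasoning
open import Relation.Nullary.Decidable.Core using (⌊_⌋; yes; no)
open import Relation.Nullary.Negation.Core using (contradiction)

-- ℚ[x₀,…,x_{m-1}] as the free commutative ℚ-algebra on `Fin m`: terms modulo
-- the least congruence _≈_ satisfying the commutative ring axioms and making
-- `con` a ring homomorphism.

infix  8 -_
infixl 7 _*_
infixl 6 _+_

data Poly (m : ℕ) : Set where
  con     : ℚ → Poly m
  var     : Fin m → Poly m
  _+_ _*_ : Poly m → Poly m → Poly m
  -_      : Poly m → Poly m

infix 4 _≈_

data _≈_ {m : ℕ} : Poly m → Poly m → Set where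
  ≈-refl      : ∀ {p} → p ≈ p
  ≈-sym       : ∀ {p q} → p ≈ q → q ≈ p
  ≈-trans     : ∀ {p q r} → p ≈ q → q ≈ r → p ≈ r
  +-cong      : ∀ {p p′ q q′} → p ≈ p′ → q ≈ q′ → p + q ≈ p′ + q′
  *-cong      : ∀ {p p′ q q′} → p ≈ p′ → q ≈ q′ → p * q ≈ p′ * q′
  -‿cong      : ∀ {p p′} → p ≈ p′ → - p ≈ - p′
  +-assoc     : ∀ p q r → (p + q) + r ≈ p + (q + r)
  +-comm      : ∀ p q → p + q ≈ q + p
  +-identityˡ : ∀ p → con 0ℚ + p ≈ p
  -‿inverseˡ  : ∀ p → - p + p ≈ con 0ℚ
  *-assoc     : ∀ p q r → (p * q) * r ≈ p * (q * r)
  *-comm      : ∀ p q → p * q ≈ q * p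
  *-identityˡ : ∀ p → con 1ℚ * p ≈ p
  distribˡ    : ∀ p q r → p * (q + r) ≈ p * q + p * r
  con-+       : ∀ a b → con (a ℚ.+ b) ≈ con a + con b
  con-*       : ∀ a b → con (a ℚ.* b) ≈ con a * con b

polyRing : ℕ → CommutativeRing 0ℓ 0ℓ
polyRing m = record
  { Carrier = Poly m
  ; _≈_ = _≈_
  ; _+_ = _+_
  ; _*_ = _*_
  ; -_ = -_
  ; 0# = con 0ℚ
  ; 1# = con 1ℚ
  ; isCommutativeRing = record
    { isRing = record
      { +-isAbelianGroup = record
        { isGroup = record
          { isMonoid = record
            { isSemigroup = record
              { isMagma = record
                { isEquivalence = record
                  { refl = ≈-refl ; sym = ≈-sym ; trans = ≈-trans }
                ; ∙-cong = +-cong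
                }
              ; assoc = +-assoc
              }
            ; identity = +-identityˡ
                       , λ p → ≈-trans (+-comm p _) (+-identityˡ p)
            }
          ; inverse = -‿inverseˡ
                    , λ p → ≈-trans (+-comm p _) (-‿inverseˡ p)
          ; ⁻¹-cong = -‿cong
          }
        ; comm = +-comm
        }
      ; *-cong = *-cong
      ; *-assoc = *-assoc
      ; *-identity = *-identityˡ
                   , λ p → ≈-trans (*-comm p _) (*-identityˡ p)
      ; distrib = distribˡ
                , λ p q r → ≈-trans (*-comm (q + r) p)
                    (≈-trans (distribˡ p q r)
                      (+-cong (*-comm p q) (*-comm p r)))
      }
    ; *-comm = *-comm
    }
  }

module _ {m : ℕ} where
  open CommutativeRing (polyRing m) public
    using (zeroˡ; zeroʳ; distribʳ; +-identityʳ; *-identityʳ; +-congˡ;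
           +-congʳ; *-congˡ; *-congʳ; -‿inverseʳ)
  open SemiringSum (CommutativeRing.semiring (polyRing m)) public
    using (sum-syntax; sum-cong-≋; sum-replicate-zero; ∑-distrib-+;
           *-distribˡ-sum; *-distribʳ-sum)

infixr 8 _•_

_•_ : ∀ {m} → ℚ → Poly m → Poly m
a • p = con a * p

polyModule : (m : ℕ) → LeftModule (CommutativeRing.ring ℚ.+-*-commutativeRing) 0ℓ 0ℓ
polyModule m = record
  { Carrierᴹ = Poly m
  ; _≈ᴹ_ = _≈_
  ; _+ᴹ_ = _+_
  ; _*ₗ_ = _•_
  ; 0ᴹ = con 0ℚ
  ; -ᴹ_ = -_
  ; isLeftModule = record
    { isLeftSemimodule = record
      { +ᴹ-isCommutativeMonoid = CommutativeRing.+-isCommutativeMonoid (polyRing m)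
      ; isPreleftSemimodule = record
        { *ₗ-cong = λ { ≡.refl p≈q → *-congˡ p≈q }
        ; *ₗ-zeroˡ = zeroˡ
        ; *ₗ-distribʳ = λ p a b → ≈-trans (*-congʳ (con-+ a b)) (distribʳ p _ _)
        ; *ₗ-identityˡ = *-identityˡ
        ; *ₗ-assoc = λ a b p → ≈-trans (*-congʳ (con-* a b)) (*-assoc _ _ p)
        ; *ₗ-zeroʳ = λ a → zeroʳ (con a)
        ; *ₗ-distribˡ = λ a → distribˡ (con a)
        }
      }
    ; -ᴹ‿cong = -‿cong
    ; -ᴹ‿inverse = CommutativeRing.-‿inverse (polyRing m)
    }
  }

IsLinear : ∀ {m} → (Poly m → Poly m) → Set
IsLinear {m} = LeftModuleMorphisms.IsLeftModuleHomomorphism M M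
  where M = LeftModule.rawLeftModule (polyModule m)

record IsDerivation {m} (d : Poly m → Poly m) : Set where
  field
    isLinear : IsLinear d
    leibniz  : ∀ p q → d (p * q) ≈ d p * q + p * d q

-- `1` is not required to be preserved.
record IsIntertwining {m} (d e ψ : Poly m → Poly m) : Set where
  field
    isLinear   : IsLinear ψ
    *-homo     : ∀ p q → ψ (p * q) ≈ ψ p * ψ q
    intertwine : ∀ p → ψ (d p) ≈ e (ψ p)

-- Non-collapse of _≈_: it is sound for evaluation at rational points.

eval : ∀ {m} → (Fin m → ℚ) → Poly m → ℚ
eval ρ (con a) = a
eval ρ (var i) = ρ i
eval ρ (p + q) = eval ρ p ℚ.+ eval ρ q
eval ρ (p * q) = eval ρ p ℚ.* eval ρ q
eval ρ (- p)   = ℚ.- eval ρ p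

eval-cong : ∀ {m} (ρ : Fin m → ℚ) {p q} → p ≈ q → eval ρ p ≡ eval ρ q
eval-cong ρ ≈-refl            = ≡.refl
eval-cong ρ (≈-sym e)         = ≡.sym (eval-cong ρ e)
eval-cong ρ (≈-trans e f)     = ≡.trans (eval-cong ρ e) (eval-cong ρ f)
eval-cong ρ (+-cong e f)      = ≡.cong₂ ℚ._+_ (eval-cong ρ e) (eval-cong ρ f)
eval-cong ρ (*-cong e f)      = ≡.cong₂ ℚ._*_ (eval-cong ρ e) (eval-cong ρ f)
eval-cong ρ (-‿cong e)        = ≡.cong ℚ.-_ (eval-cong ρ e)
eval-cong ρ (+-assoc p q r)   = ℚ.+-assoc (eval ρ p) (eval ρ q) (eval ρ r)
eval-cong ρ (+-comm p q)      = ℚ.+-comm (eval ρ p) (eval ρ q)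
eval-cong ρ (+-identityˡ p)   = ℚ.+-identityˡ (eval ρ p)
eval-cong ρ (-‿inverseˡ p)    = ℚ.+-inverseˡ (eval ρ p)
eval-cong ρ (*-assoc p q r)   = ℚ.*-assoc (eval ρ p) (eval ρ q) (eval ρ r)
eval-cong ρ (*-comm p q)      = ℚ.*-comm (eval ρ p) (eval ρ q)
eval-cong ρ (*-identityˡ p)   = ℚ.*-identityˡ (eval ρ p)
eval-cong ρ (distribˡ p q r)  = ℚ.*-distribˡ-+ (eval ρ p) (eval ρ q) (eval ρ r)
eval-cong ρ (con-+ a b)       = ≡.refl
eval-cong ρ (con-* a b)       = ≡.refl

-- The derivation with prescribed values on the variables.
derive : ∀ {m} → (Fin m → Poly m) → Poly m → Poly m
derive v (con a) = con 0ℚ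
derive v (var i) = v i
derive v (p + q) = derive v p + derive v q
derive v (p * q) = derive v p * q + p * derive v q
derive v (- p)   = - derive v p

δ : ∀ {m} → Fin m → Fin m → Poly m
δ i j = con (if ⌊ i ≟ j ⌋ then 1ℚ else 0ℚ)

∂ : ∀ {m} → Fin m → Poly m → Poly m
∂ i = derive (δ i)

x : ∀ {N} n → .(n ℕ.≤ N) → Poly (suc N)
x n n≤N = var (fromℕ< (s≤s n≤N))

-- The summand for k is n x_{n-1} ∂/∂x_n with n = toℕ k + 1.
𝒟 : ∀ N → Poly (suc N) → Poly (suc N)
𝒟 N p = ∑[ k < N ] ((ℤ.+ suc (toℕ k) ℚ./ 1) • var (inject₁ k) * ∂ (suc k) p)

κ : (i : ℕ) .{{_ : ℕ.NonZero i}} → ℚ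
κ i = (1ℤ ℤ.- -1ℤ ℤ.^ i) ℚ./ (2 ℕ.* i)
  where instance _ = ℕ.m*n≢0 2 i

-- The value on x_n, n = toℕ k, with summation index i = toℕ j + 1; the sum is
-- empty for n = 0.
𝒦₁-values : ∀ N → Fin (suc N) → Poly (suc N)
𝒦₁-values N k = ∑[ j < toℕ k ] (κ (suc (toℕ j)) • x (toℕ k ∸ suc (toℕ j)) (bound j))
  where
  bound : (j : Fin (toℕ k)) → toℕ k ∸ suc (toℕ j) ℕ.≤ N
  bound j = ℕ.≤-trans (ℕ.m∸n≤m (toℕ k) (suc (toℕ j))) (ℕ.s≤s⁻¹ (toℕ<n k))

𝒦₁ : ∀ N → Poly (suc N) → Poly (suc N)
𝒦₁ N = derive (𝒦₁-values N)

-- Stirling numbers of the second kind.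
S : ℕ → ℕ → ℕ
S zero    zero    = 1
S zero    (suc k) = 0
S (suc n) zero    = 0
S (suc n) (suc k) = suc k ℕ.* S n (suc k) ℕ.+ S n k

sumFromTo : ℕ → ℕ → (ℕ → ℚ) → ℚ
sumFromTo a b f = ℚ-sum λ (d : Fin (suc b ∸ a)) → f (a ℕ.+ toℕ d)
  where
  open SemiringSum (CommutativeRing.semiring ℚ.+-*-commutativeRing)
    renaming (sum to ℚ-sum)

syntax sumFromTo a b (λ j → e) = ∑[ j from a to b ] e

-- Both maps are indeed derivations, with the expected values on the variables.

module _ {m : ℕ} where
  private
    module R = CommutativeRing (polyRing m)
  open AbelianGroupProperties R.+-abelianGroup using (inverseˡ-unique; identityˡ-unique)
  open CommutativeSemigroupProperties R.+-commutativeSemigroup using (interchange)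
  open SetoidReasoning R.setoid

  mkDerivation : {d : Poly m → Poly m} →
    (∀ {p q} → p ≈ q → d p ≈ d q) →
    (∀ p q → d (p + q) ≈ d p + d q) →
    (∀ a p → d (a • p) ≈ a • d p) →
    (∀ p q → d (p * q) ≈ d p * q + p * d q) →
    IsDerivation d
  mkDerivation {d} cong add scale leib = record
    { isLinear = record
      { +ᴹ-isGroupHomomorphism = record
        { isMonoidHomomorphism = record
          { isMagmaHomomorphism = record
            { isRelHomomorphism = record { cong = cong } ; homo = add }
          ; ε-homo = d0
          }
        ; ⁻¹-homo = λ p → inverseˡ-unique (d (- p)) (d p)
            (≈-trans (≈-sym (add (- p) p)) (≈-trans (cong (-‿inverseˡ p)) d0))
        }
      ; *ₗ-homo = scale
      }
    ; leibniz = leib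
    }
    where
    d0 : d (con 0ℚ) ≈ con 0ℚ
    d0 = ≈-trans (cong (≈-sym (zeroˡ (con 0ℚ)))) (≈-trans (scale 0ℚ (con 0ℚ)) (zeroˡ _))

  module _ (v : Fin m → Poly m) where
    derive-cong : ∀ {p q} → p ≈ q → derive v p ≈ derive v q
    derive-cong ≈-refl           = ≈-refl
    derive-cong (≈-sym e)        = ≈-sym (derive-cong e)
    derive-cong (≈-trans e f)    = ≈-trans (derive-cong e) (derive-cong f)
    derive-cong (+-cong e f)     = +-cong (derive-cong e) (derive-cong f)
    derive-cong (*-cong e f)     =
      +-cong (*-cong (derive-cong e) f) (*-cong e (derive-cong f))
    derive-cong (-‿cong e)       = -‿cong (derive-cong e)
    derive-cong (+-assoc p q r)  = +-assoc _ _ _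
    derive-cong (+-comm p q)     = +-comm _ _
    derive-cong (+-identityˡ p)  = +-identityˡ _
    derive-cong (-‿inverseˡ p)   = -‿inverseˡ _
    derive-cong (*-assoc p q r)  = begin
      (p′ * q + p * q′) * r + p * q * r′      ≈⟨ +-congʳ (distribʳ r _ _) ⟩
      (p′ * q * r + p * q′ * r) + p * q * r′  ≈⟨ +-assoc _ _ _ ⟩
      p′ * q * r + (p * q′ * r + p * q * r′)
        ≈⟨ +-cong (*-assoc _ _ _) (+-cong (*-assoc _ _ _) (*-assoc _ _ _)) ⟩
      p′ * (q * r) + (p * (q′ * r) + p * (q * r′)) ≈⟨ +-congˡ (distribˡ p _ _) ⟨
      p′ * (q * r) + p * (q′ * r + q * r′)    ∎
      where
      p′ = derive v p
      q′ = derive v q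
      r′ = derive v r
    derive-cong (*-comm p q)     =
      ≈-trans (+-comm _ _) (+-cong (*-comm _ _) (*-comm _ _))
    derive-cong (*-identityˡ p)  =
      ≈-trans (+-cong (zeroˡ p) (*-identityˡ _)) (+-identityˡ _)
    derive-cong (distribˡ p q r) =
      ≈-trans (+-cong (distribˡ _ q r) (distribˡ p _ _)) (interchange _ _ _ _)
    derive-cong (con-+ a b)      = ≈-sym (+-identityˡ _)
    derive-cong (con-* a b)      = ≈-sym
      (≈-trans (+-cong (zeroˡ _) (zeroʳ _)) (+-identityˡ _))

    derive-isDerivation : IsDerivation (derive v)
    derive-isDerivation = mkDerivation derive-cong (λ _ _ → ≈-refl)
      (λ a p → ≈-trans (+-congʳ (zeroˡ p)) (+-identityˡ _)) (λ _ _ → ≈-refl)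

    derive-unique : ∀ {d} → IsDerivation d → (∀ i → d (var i) ≈ v i) →
      ∀ p → d p ≈ derive v p
    derive-unique {d} isD d-var = go
      where
      open IsDerivation isD
      open LeftModuleMorphisms.IsLeftModuleHomomorphism isLinear

      d1 : d (con 1ℚ) ≈ con 0ℚ
      d1 = identityˡ-unique _ _ (begin
        d (con 1ℚ) + d (con 1ℚ)
          ≈⟨ +-cong (*-identityʳ _) (*-identityˡ _) ⟨
        d (con 1ℚ) * con 1ℚ + con 1ℚ * d (con 1ℚ) ≈⟨ leibniz _ _ ⟨
        d (con 1ℚ * con 1ℚ)                       ≈⟨ ⟦⟧-cong (*-identityˡ _) ⟩
        d (con 1ℚ)                                ∎)

      go : ∀ p → d p ≈ derive v p
      go (con a) = begin
        d (con a)      ≈⟨ ⟦⟧-cong (*-identityʳ _) ⟨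
        d (a • con 1ℚ) ≈⟨ *ₗ-homo a (con 1ℚ) ⟩
        a • d (con 1ℚ) ≈⟨ *-congˡ d1 ⟩
        a • con 0ℚ     ≈⟨ zeroʳ _ ⟩
        con 0ℚ         ∎
      go (var i) = d-var i
      go (p + q) = ≈-trans (+ᴹ-homo p q) (+-cong (go p) (go q))
      go (p * q) = ≈-trans (leibniz p q) (+-cong (*-congʳ (go p)) (*-congˡ (go q)))
      go (- p)   = ≈-trans (-ᴹ-homo p) (-‿cong (go p))

  private
    ∑-cong : ∀ n {f g : Fin n → Poly m} → (∀ i → f i ≈ g i) →
      ∑[ i < n ] f i ≈ ∑[ i < n ] g i
    ∑-cong n = sum-cong-≋ {m = m} {n = n}

    *-swap : (p q r : Poly m) → p * (q * r) ≈ q * (p * r)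
    *-swap p q r = ≈-trans (≈-sym (*-assoc p q r))
      (≈-trans (*-congʳ (*-comm p q)) (*-assoc q p r))

  ∑∂-isDerivation : ∀ {n} (c : Fin n → Poly m) (i : Fin n → Fin m) →
    IsDerivation λ p → ∑[ k < n ] (c k * ∂ (i k) p)
  ∑∂-isDerivation {n} c i = mkDerivation
    (λ e → ∑-cong n λ k → *-congˡ (derive-cong (δ (i k)) e))
    (λ p q → ≈-trans (∑-cong n λ k → distribˡ (c k) _ _) (∑-distrib-+ {n = n} _ _))
    (λ a p → ≈-trans
      (∑-cong n λ k → ≈-trans (*-congˡ (•-homo k a p)) (*-swap (c k) (con a) (∂ (i k) p)))
      (≈-sym (*-distribˡ-sum {n = n} (con a) _)))
    (λ p q → begin
      ∑[ k < n ] (c k * (∂ (i k) p * q + p * ∂ (i k) q))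
        ≈⟨ ∑-cong n (λ k → ≈-trans (distribˡ (c k) _ _)
             (+-cong (≈-sym (*-assoc _ _ q)) (*-swap (c k) p (∂ (i k) q)))) ⟩
      ∑[ k < n ] (c k * ∂ (i k) p * q + p * (c k * ∂ (i k) q))
        ≈⟨ ∑-distrib-+ {n = n} _ _ ⟩
      (∑[ k < n ] (c k * ∂ (i k) p * q)) + (∑[ k < n ] (p * (c k * ∂ (i k) q)))
        ≈⟨ +-cong (*-distribʳ-sum {n = n} q _) (*-distribˡ-sum {n = n} p _) ⟨
      (∑[ k < n ] (c k * ∂ (i k) p)) * q + p * (∑[ k < n ] (c k * ∂ (i k) q)) ∎)
    where
    •-homo : ∀ k a p → ∂ (i k) (a • p) ≈ a • ∂ (i k) p
    •-homo k = LeftModuleMorphisms.IsLeftModuleHomomorphism.*ₗ-homo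
      (IsDerivation.isLinear (derive-isDerivation _))

𝒟-isDerivation : ∀ N → IsDerivation (𝒟 N)
𝒟-isDerivation N = ∑∂-isDerivation
  (λ k → (ℤ.+ suc (toℕ k) ℚ./ 1) • var (inject₁ k)) suc

𝒦₁-isDerivation : ∀ N → IsDerivation (𝒦₁ N)
𝒦₁-isDerivation N = derive-isDerivation (𝒦₁-values N)

𝒟-x₀ : ∀ N → 𝒟 N (var zero) ≈ con 0ℚ
𝒟-x₀ N = ≈-trans (sum-cong-≋ {n = N} λ k → zeroʳ _) (sum-replicate-zero N)

𝒟-xₙ : ∀ N (k : Fin N) →
  𝒟 N (var (suc k)) ≈ (ℤ.+ suc (toℕ k) ℚ./ 1) • var (inject₁ k)
𝒟-xₙ N k = pick N k (λ j → (ℤ.+ suc (toℕ j) ℚ./ 1) • var (inject₁ j))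
  (λ j → δ (suc j) (suc k)) one other
  where
  one : δ (suc k) (suc k) ≈ con 1ℚ
  one with suc k ≟ suc k
  ... | yes _   = ≈-refl
  ... | no k≢k  = contradiction ≡.refl k≢k

  other : ∀ j → j ≢ k → δ (suc j) (suc k) ≈ con 0ℚ
  other j j≢k with suc j ≟ suc k
  ... | yes eq = contradiction (suc-injective eq) j≢k
  ... | no _   = ≈-refl

  pick : ∀ {m} n (i : Fin n) (c e : Fin n → Poly m) → e i ≈ con 1ℚ →
    (∀ j → j ≢ i → e j ≈ con 0ℚ) → ∑[ j < n ] (c j * e j) ≈ c i
  pick (suc n) zero c e e₁ e₀ = ≈-trans
    (+-cong (≈-trans (*-congˡ e₁) (*-identityʳ _))
      (≈-trans (sum-cong-≋ {n = n} λ j →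
          ≈-trans (*-congˡ (e₀ (suc j) λ ())) (zeroʳ _))
        (sum-replicate-zero n)))
    (+-identityʳ _)
  pick (suc n) (suc i) c e e₁ e₀ = ≈-trans
    (+-cong (≈-trans (*-congˡ (e₀ zero λ ())) (zeroʳ _))
      (pick n i (c ∘ suc) (e ∘ suc) e₁ (λ j j≢i → e₀ (suc j) (j≢i ∘ suc-injective))))
    (+-identityˡ _)

{-# OPTIONS --safe #-}

-- On the variables 𝒦₁ acts as artanh of the backward shift x_n ↦ x_{n-1}, and
-- 𝒟 as d/dt on exponential generating functions, so an intertwining map of the
-- given form must have T(n,i) = n! [tⁿ] tanhⁱ t.
-- (1) From (tanhⁱ)′ = i (tanhⁱ⁻¹ - tanhⁱ⁺¹) these numbers G satisfy
--     G(n+1,i) = i (G(n,i-1) - G(n,i+1)), and since i κ(i) is 1 for odd i and 0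
--     for even i, induction on n with a telescoping sum gives
--     Σ_{k≥1} G(n,m+k) κ(k) = n G(n-1,m).
-- (2) Extracting the coefficient of x_m from ψ 𝒟 x_n = 𝒦₁ ψ x_n gives the same
--     recurrence for T; as κ(1) = 1, it is triangular and determines T.
-- (3) With w = (e²ᵗ - 1)/2 one has tanh t = w/(1+w). Expanding (w/(1+w))ⁱ in
--     powers of w, and these in t, yields the signed binomial coefficients and
--     the Stirling numbers.
module Submission where

open import Defs
open import Data.Nat.Base as ℕ using (ℕ; zero; suc; _≤_; _<_; z≤n; s≤s; _∸_; _^_; _!)
open import Data.Nat.Combinatorics using (_C_; nCn≡1; nCk+nC[k+1]≡[n+1]C[k+1])
open import Data.Nat.Properties using (≤-trans)
open import Data.Integer.Base as ℤ using (ℤ; +_; -1ℤ; 0ℤ; 1ℤ)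
open import Data.Rational.Base as ℚ using (ℚ; 0ℚ; 1ℚ)
open import Data.Fin.Base using (Fin; zero; suc; toℕ; fromℕ<)
open import Data.Fin.Properties using (toℕ<n; toℕ-fromℕ<; toℕ-inject₁; toℕ-injective)
open import Relation.Binary.PropositionalEquality.Core using (_≡_)

open import Algebra.Bundles using (CommutativeRing)
open import Algebra.Module.Morphism.Structures using (module LeftModuleMorphisms)
import Algebra.Properties.Group as GroupProperties
import Algebra.Properties.Semiring.Sum as SemiringSum
import Data.Integer.Properties as ℤ
open import Data.Integer.Tactic.RingSolver using () renaming (solve-∀ to solveℤ-∀)
import Data.Nat.Properties as ℕ
open import Data.Nat.Tactic.RingSolver using () renaming (solve-∀ to solveℕ-∀)
import Data.Rational.Properties as ℚ
import Data.Rational.Unnormalised.Base as ℚᵘ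
import Data.Rational.Unnormalised.Properties as ℚᵘ
open import Function.Base using (_∘_)
open import Level using (0ℓ)
open import Relation.Binary.PropositionalEquality
  using (refl; sym; trans; cong; cong₂; subst; module ≡-Reasoning)
open import Relation.Nullary.Decidable.Core using (yes; no; dec⇒maybe)
open import Tactic.RingSolver using () renaming (solve-∀ to solve-∀-in)
open import Tactic.RingSolver.Core.AlmostCommutativeRing
  using (AlmostCommutativeRing; fromCommutativeRing)

open ≡-Reasoning

ℚ-ring : AlmostCommutativeRing 0ℓ 0ℓ
ℚ-ring = fromCommutativeRing ℚ.+-*-commutativeRing λ p → dec⇒maybe (0ℚ ℚ.≟ p)

-- Finite sums over initial segments of the naturals.

module Sums {c ℓ} (R : CommutativeRing c ℓ) where
  private module R = CommutativeRing R
  open R using (Carrier; 0#) renaming (_≈_ to _≋_; _+_ to _⊕_)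
  open SemiringSum R.semiring using (sum)

  -- Summands are functions on `ℕ` rather than on `Fin n`, so shifting and truncating need no casts.
  ∑ : ℕ → (ℕ → Carrier) → Carrier
  ∑ n f = sum {n} (f ∘ toℕ)

  ∑-cong : ∀ n {f g : ℕ → Carrier} → (∀ k → k < n → f k ≋ g k) → ∑ n f ≋ ∑ n g
  ∑-cong zero    f≋g = R.refl
  ∑-cong (suc n) f≋g =
    R.+-cong (f≋g 0 (s≤s z≤n)) (∑-cong n λ k k<n → f≋g (suc k) (s≤s k<n))

  ∑-zero : ∀ n {f : ℕ → Carrier} → (∀ k → k < n → f k ≋ 0#) → ∑ n f ≋ 0#
  ∑-zero zero    f≋0 = R.refl
  ∑-zero (suc n) f≋0 = R.trans
    (R.+-cong (f≋0 0 (s≤s z≤n)) (∑-zero n λ k k<n → f≋0 (suc k) (s≤s k<n)))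
    (R.+-identityˡ 0#)

  ∑-drop : ∀ m n {f : ℕ → Carrier} → (∀ k → k < m → f k ≋ 0#) →
    ∑ n f ≋ ∑ (n ∸ m) (λ k → f (m ℕ.+ k))
  ∑-drop zero    n       f≋0 = R.refl
  ∑-drop (suc m) zero    f≋0 = R.refl
  ∑-drop (suc m) (suc n) f≋0 = R.trans
    (R.+-cong (f≋0 0 (s≤s z≤n)) (∑-drop m n λ k k<m → f≋0 (suc k) (s≤s k<m)))
    (R.+-identityˡ _)

  ∑-shift : ∀ n (f : ℕ → Carrier) → f 0 ⊕ ∑ n (f ∘ suc) ≋ ∑ n f ⊕ f n
  ∑-shift zero    f = R.+-comm _ _
  ∑-shift (suc n) f =
    R.trans (R.+-congˡ (∑-shift n (f ∘ suc))) (R.sym (R.+-assoc _ _ _))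

open Sums ℤ.+-*-commutativeRing using () renaming
  (∑ to ∑ℤ; ∑-cong to ∑ℤ-cong; ∑-zero to ∑ℤ-zero; ∑-drop to ∑ℤ-drop; ∑-shift to ∑ℤ-shift)
open Sums ℚ.+-*-commutativeRing using () renaming
  (∑ to ∑ℚ; ∑-cong to ∑ℚ-cong; ∑-zero to ∑ℚ-zero; ∑-drop to ∑ℚ-drop)
private
  module ℤS = SemiringSum (CommutativeRing.semiring ℤ.+-*-commutativeRing)
  module ℚS = SemiringSum (CommutativeRing.semiring ℚ.+-*-commutativeRing)

-- Integers as rationals

ι : ℤ → ℚ
ι z = z ℚ./ 1

-- Normalisation of fractions blocks computation on a variable `z`; the homomorphism laws of `ι` are
-- therefore checked on unnormalised fractions.
toℚᵘ-ι : ∀ z → ℚ.toℚᵘ (ι z) ℚᵘ.≃ ℚᵘ.mkℚᵘ z 0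
toℚᵘ-ι z = ℚ.toℚᵘ-fromℚᵘ (ℚᵘ.mkℚᵘ z 0)

ι-+ : ∀ y z → ι (y ℤ.+ z) ≡ ι y ℚ.+ ι z
ι-+ y z = ℚ.toℚᵘ-injective (ℚᵘ.≃-trans (toℚᵘ-ι (y ℤ.+ z)) (ℚᵘ.≃-sym
  (ℚᵘ.≃-trans (ℚ.toℚᵘ-homo-+ (ι y) (ι z))
    (ℚᵘ.≃-trans (ℚᵘ.+-cong (toℚᵘ-ι y) (toℚᵘ-ι z)) (ℚᵘ.*≡* (lemma y z))))))
  where
  lemma : ∀ y z → (y ℤ.* 1ℤ ℤ.+ z ℤ.* 1ℤ) ℤ.* 1ℤ ≡ (y ℤ.+ z) ℤ.* 1ℤ
  lemma = solveℤ-∀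

ι-* : ∀ y z → ι (y ℤ.* z) ≡ ι y ℚ.* ι z
ι-* y z = ℚ.toℚᵘ-injective (ℚᵘ.≃-trans (toℚᵘ-ι (y ℤ.* z)) (ℚᵘ.≃-sym
  (ℚᵘ.≃-trans (ℚ.toℚᵘ-homo-* (ι y) (ι z))
    (ℚᵘ.*-cong (toℚᵘ-ι y) (toℚᵘ-ι z)))))

ι-neg : ∀ z → ι (ℤ.- z) ≡ ℚ.- ι z
ι-neg z = ℚ.toℚᵘ-injective (ℚᵘ.≃-trans (toℚᵘ-ι (ℤ.- z)) (ℚᵘ.≃-sym
  (ℚᵘ.≃-trans (ℚ.toℚᵘ-homo‿- (ι z)) (ℚᵘ.-‿cong (toℚᵘ-ι z)))))

ι-- : ∀ y z → ι (y ℤ.- z) ≡ ι y ℚ.- ι z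
ι-- y z = trans (ι-+ y (ℤ.- z)) (cong (ι y ℚ.+_) (ι-neg z))

ι-∑ : ∀ n f → ι (∑ℤ n f) ≡ ∑ℚ n (ι ∘ f)
ι-∑ zero    f = refl
ι-∑ (suc n) f = trans (ι-+ (f 0) _) (cong (ι (f 0) ℚ.+_) (ι-∑ n (f ∘ suc)))

-- The numbers n! [tⁿ] tanhⁱ t

G : ℕ → ℕ → ℤ
G zero    zero    = 1ℤ
G zero    (suc i) = 0ℤ
G (suc n) zero    = 0ℤ
G (suc n) (suc i) = + suc i ℤ.* (G n i ℤ.- G n (suc (suc i)))

-- The series tanhⁱ t has order i at t = 0.
G-vanish : ∀ {n i} → n < i → G n i ≡ 0ℤ
G-vanish {zero}  {suc i} _         = refl
G-vanish {suc n} {suc i} (s≤s n<i)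
  rewrite G-vanish {n} {i} n<i
        | G-vanish {n} {suc (suc i)} (ℕ.m<n⇒m<1+n (ℕ.m<n⇒m<1+n n<i)) = ℤ.*-zeroʳ (+ suc i)

g : ℕ → ℕ → ℚ
g n i = ι (G n i)

g-suc : ∀ n i → g (suc n) (suc i) ≡ ι (+ suc i) ℚ.* (g n i ℚ.- g n (suc (suc i)))
g-suc n i = trans
  (ι-* (+ suc i) (G n i ℤ.- G n (suc (suc i))))
  (cong (ι (+ suc i) ℚ.*_) (ι-- (G n i) (G n (suc (suc i)))))

-- Convolution of these numbers with the coefficients κ.

parity : ℕ → ℤ
parity zero          = 0ℤ
parity (suc zero)    = 1ℤ
parity (suc (suc i)) = parity i

1-[-1]^i : ∀ i → 1ℤ ℤ.- -1ℤ ℤ.^ i ≡ + 2 ℤ.* parity i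
1-[-1]^i zero          = refl
1-[-1]^i (suc zero)    = refl
1-[-1]^i (suc (suc i)) = trans (lemma (-1ℤ ℤ.^ i)) (1-[-1]^i i)
  where
  lemma : ∀ s → 1ℤ ℤ.- -1ℤ ℤ.* (-1ℤ ℤ.* s) ≡ 1ℤ ℤ.- s
  lemma = solveℤ-∀

i*κ : ∀ k → ι (+ suc k) ℚ.* κ (suc k) ≡ ι (parity (suc k))
i*κ k = ℚ.toℚᵘ-injective
  (ℚᵘ.≃-trans (ℚ.toℚᵘ-homo-* (ι (+ suc k)) (κ (suc k)))
  (ℚᵘ.≃-trans (ℚᵘ.*-cong (toℚᵘ-ι (+ suc k)) (ℚ.toℚᵘ-fromℚᵘ (ℚᵘ.mkℚᵘ z _)))
  (ℚᵘ.≃-trans (ℚᵘ.*≡* cross) (ℚᵘ.≃-sym (toℚᵘ-ι (parity (suc k)))))))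
  where
  z = 1ℤ ℤ.- -1ℤ ℤ.^ suc k

  lemma : ∀ i p → i ℤ.* (+ 2 ℤ.* p) ℤ.* 1ℤ ≡ p ℤ.* (+ 2 ℤ.* i)
  lemma = solveℤ-∀

  -- Equality of fractions by cross multiplication; `1 * (2 * suc k)` is the denominator of the
  -- product before normalisation.
  cross : + suc k ℤ.* (1ℤ ℤ.- -1ℤ ℤ.^ suc k) ℤ.* 1ℤ ≡ parity (suc k) ℤ.* + (1 ℕ.* (2 ℕ.* suc k))
  cross = begin
    + suc k ℤ.* (1ℤ ℤ.- -1ℤ ℤ.^ suc k) ℤ.* 1ℤ
      ≡⟨ cong (λ s → + suc k ℤ.* s ℤ.* 1ℤ) (1-[-1]^i (suc k)) ⟩
    + suc k ℤ.* (+ 2 ℤ.* parity (suc k)) ℤ.* 1ℤ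
      ≡⟨ lemma (+ suc k) (parity (suc k)) ⟩
    parity (suc k) ℤ.* (+ 2 ℤ.* + suc k)
      ≡⟨ cong (parity (suc k) ℤ.*_) (ℤ.pos-* 2 (suc k)) ⟨
    parity (suc k) ℤ.* + (2 ℕ.* suc k)
      ≡⟨ cong (λ t → parity (suc k) ℤ.* + t) (ℕ.*-identityˡ (2 ℕ.* suc k)) ⟨
    parity (suc k) ℤ.* + (1 ℕ.* (2 ℕ.* suc k)) ∎

-- Only even k contribute, and the differences f(2l) - f(2l+2) collapse to f 0 because f vanishes
-- from B on. The induction removes two summands at a time.
parity-telescope : ∀ B (f : ℕ → ℚ) → (∀ k → B ≤ k → f k ≡ 0ℚ) →
  ∑ℚ B (λ k → ι (parity (suc k)) ℚ.* (f k ℚ.- f (suc (suc k)))) ≡ f 0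
parity-telescope zero          f f≡0 = sym (f≡0 0 z≤n)
parity-telescope (suc zero)    f f≡0 rewrite f≡0 2 (s≤s z≤n) = lemma (f 0)
  where
  lemma : ∀ u → 1ℚ ℚ.* (u ℚ.- 0ℚ) ℚ.+ 0ℚ ≡ u
  lemma = solve-∀-in ℚ-ring
parity-telescope (suc (suc B)) f f≡0 = trans
  (cong (λ s → 1ℚ ℚ.* (f 0 ℚ.- f 2) ℚ.+ (0ℚ ℚ.* (f 1 ℚ.- f 3) ℚ.+ s))
    (parity-telescope B (λ k → f (suc (suc k))) λ k B≤k → f≡0 (suc (suc k)) (s≤s (s≤s B≤k))))
  (lemma (f 0) (f 2) (f 1 ℚ.- f 3))
  where
  lemma : ∀ u v w → 1ℚ ℚ.* (u ℚ.- v) ℚ.+ (0ℚ ℚ.* w ℚ.+ v) ≡ u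
  lemma = solve-∀-in ℚ-ring

-- With u = tanh t this is n! [tⁿ] of artanh(u) uᵐ = t uᵐ, since Σ κ(k) uᵏ = artanh u. The bound on
-- B ensures that all omitted summands vanish; at n = 0 the value of `pred` is multiplied by 0.
g-κ : ∀ n m B → n ≤ m ℕ.+ B →
  ∑ℚ B (λ k → g n (suc (m ℕ.+ k)) ℚ.* κ (suc k)) ≡ ι (+ n) ℚ.* g (ℕ.pred n) m
g-κ zero    m B _ = trans
  (∑ℚ-zero B λ k _ → ℚ.*-zeroˡ (κ (suc k))) (sym (ℚ.*-zeroˡ (g 0 m)))
g-κ (suc n) m B n<m+B = begin
  ∑ℚ B (λ k → g (suc n) (suc (m ℕ.+ k)) ℚ.* κ (suc k))
    -- The recurrence for G(n+1,m+k), with k counted from 1, has the factor m + k. The part k turns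
    -- κ(k) into a parity, and the sum telescopes; the part m leads to the induction hypothesis.
    ≡⟨ ∑ℚ-cong B (λ k _ → split k) ⟩
  ∑ℚ B (λ k → ι (+ m) ℚ.* (u k ℚ.+ (ℚ.- 1ℚ) ℚ.* v k) ℚ.+ w k)
    ≡⟨ ℚS.∑-distrib-+ {B} _ _ ⟩
  ∑ℚ B (λ k → ι (+ m) ℚ.* (u k ℚ.+ (ℚ.- 1ℚ) ℚ.* v k)) ℚ.+ ∑ℚ B w
    ≡⟨ cong₂ ℚ._+_ (ℚS.*-distribˡ-sum {B} (ι (+ m)) _)
         (sym (parity-telescope B (λ k → g n (m ℕ.+ k)) vanish)) ⟨
  ι (+ m) ℚ.* ∑ℚ B (λ k → u k ℚ.+ (ℚ.- 1ℚ) ℚ.* v k) ℚ.+ g n (m ℕ.+ 0)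
    ≡⟨ cong₂ (λ s t → ι (+ m) ℚ.* s ℚ.+ g n t)
         (trans (ℚS.∑-distrib-+ {B} (u ∘ toℕ) _)
           (cong (∑ℚ B u ℚ.+_) (sym (ℚS.*-distribˡ-sum {B} (ℚ.- 1ℚ) _))))
         (ℕ.+-identityʳ m) ⟩
  ι (+ m) ℚ.* (∑ℚ B u ℚ.+ (ℚ.- 1ℚ) ℚ.* ∑ℚ B v) ℚ.+ g n m
    ≡⟨ cong (ℚ._+ g n m) (main m n n<m+B) ⟩
  ι (+ n) ℚ.* g n m ℚ.+ g n m
    ≡⟨ collect (ι (+ n)) (g n m) ⟩
  (1ℚ ℚ.+ ι (+ n)) ℚ.* g n m
    ≡⟨ cong (ℚ._* g n m) (ι-+ 1ℤ (+ n)) ⟨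
  ι (+ suc n) ℚ.* g n m ∎
  where
  u v w : ℕ → ℚ
  u k = g n (m ℕ.+ k) ℚ.* κ (suc k)
  v k = g n (suc (suc (m ℕ.+ k))) ℚ.* κ (suc k)
  w k = ι (parity (suc k)) ℚ.* (g n (m ℕ.+ k) ℚ.- g n (m ℕ.+ suc (suc k)))

  vanish : ∀ k → B ≤ k → g n (m ℕ.+ k) ≡ 0ℚ
  vanish k B≤k = cong ι (G-vanish (≤-trans n<m+B (ℕ.+-monoʳ-≤ m B≤k)))

  collect : ∀ a b → a ℚ.* b ℚ.+ b ≡ (1ℚ ℚ.+ a) ℚ.* b
  collect = solve-∀-in ℚ-ring

  expand : ∀ i j a b c → (i ℚ.+ j) ℚ.* (a ℚ.- b) ℚ.* c ≡
    i ℚ.* (a ℚ.* c ℚ.+ (ℚ.- 1ℚ) ℚ.* (b ℚ.* c)) ℚ.+ j ℚ.* c ℚ.* (a ℚ.- b)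
  expand = solve-∀-in ℚ-ring

  split : ∀ k → g (suc n) (suc (m ℕ.+ k)) ℚ.* κ (suc k) ≡
    ι (+ m) ℚ.* (u k ℚ.+ (ℚ.- 1ℚ) ℚ.* v k) ℚ.+ w k
  split k = begin
    g (suc n) (suc (m ℕ.+ k)) ℚ.* κ (suc k)
      ≡⟨ cong (ℚ._* κ (suc k)) (g-suc n (m ℕ.+ k)) ⟩
    ι (+ suc (m ℕ.+ k)) ℚ.* (a ℚ.- b) ℚ.* κ (suc k)
      ≡⟨ cong (λ t → t ℚ.* (a ℚ.- b) ℚ.* κ (suc k))
           (trans (cong (ι ∘ +_) (sym (ℕ.+-suc m k))) (ι-+ (+ m) (+ suc k))) ⟩
    (ι (+ m) ℚ.+ ι (+ suc k)) ℚ.* (a ℚ.- b) ℚ.* κ (suc k)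
      ≡⟨ expand (ι (+ m)) (ι (+ suc k)) a b (κ (suc k)) ⟩
    ι (+ m) ℚ.* (u k ℚ.+ (ℚ.- 1ℚ) ℚ.* v k) ℚ.+ ι (+ suc k) ℚ.* κ (suc k) ℚ.* (a ℚ.- b)
      ≡⟨ cong₂ (λ s t → ι (+ m) ℚ.* (u k ℚ.+ (ℚ.- 1ℚ) ℚ.* v k) ℚ.+ s ℚ.* (a ℚ.- g n t))
           (i*κ k) (sym (trans (ℕ.+-suc m (suc k)) (cong suc (ℕ.+-suc m k)))) ⟩
    ι (+ m) ℚ.* (u k ℚ.+ (ℚ.- 1ℚ) ℚ.* v k) ℚ.+ w k ∎
    where
    a = g n (m ℕ.+ k)
    b = g n (suc (suc (m ℕ.+ k)))

  factor : ∀ i j a b → i ℚ.* (j ℚ.* a ℚ.+ (ℚ.- 1ℚ) ℚ.* (j ℚ.* b)) ≡ j ℚ.* (i ℚ.* (a ℚ.- b))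
  factor = solve-∀-in ℚ-ring

  sum₀ sum₂ : ℕ → ℕ → ℚ
  sum₀ m n = ∑ℚ B (λ k → g n (m ℕ.+ k) ℚ.* κ (suc k))
  sum₂ m n = ∑ℚ B (λ k → g n (suc (suc (m ℕ.+ k))) ℚ.* κ (suc k))

  -- For m = 0 there is no G(n,m-1), but then the factor m vanishes.
  main : ∀ m n → suc n ≤ m ℕ.+ B →
    ι (+ m) ℚ.* (sum₀ m n ℚ.+ (ℚ.- 1ℚ) ℚ.* sum₂ m n) ≡ ι (+ n) ℚ.* g n m
  main zero    zero    _ = trans
    (ℚ.*-zeroˡ (sum₀ 0 0 ℚ.+ (ℚ.- 1ℚ) ℚ.* sum₂ 0 0)) (sym (ℚ.*-zeroˡ (g 0 0)))
  main zero    (suc n) _ = trans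
    (ℚ.*-zeroˡ (sum₀ 0 (suc n) ℚ.+ (ℚ.- 1ℚ) ℚ.* sum₂ 0 (suc n)))
    (sym (ℚ.*-zeroʳ (ι (+ suc n))))
  main (suc m) n (s≤s n≤m+B) = begin
    ι (+ suc m) ℚ.* (sum₀ (suc m) n ℚ.+ (ℚ.- 1ℚ) ℚ.* sum₂ (suc m) n)
      -- Both sums are instances of the induction hypothesis, one index below and one index above
      -- `suc m`; the recurrence for G then recombines them.
      ≡⟨ cong₂ (λ s t → ι (+ suc m) ℚ.* (s ℚ.+ (ℚ.- 1ℚ) ℚ.* t))
           (g-κ n m B n≤m+B)
           (g-κ n (suc (suc m)) B (ℕ.m≤n⇒m≤1+n (ℕ.m≤n⇒m≤1+n n≤m+B))) ⟩
    ι (+ suc m) ℚ.* (ι (+ n) ℚ.* c n ℚ.+ (ℚ.- 1ℚ) ℚ.* (ι (+ n) ℚ.* d n))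
      ≡⟨ factor (ι (+ suc m)) (ι (+ n)) (c n) (d n) ⟩
    ι (+ n) ℚ.* (ι (+ suc m) ℚ.* (c n ℚ.- d n))
      ≡⟨ last n ⟩
    ι (+ n) ℚ.* g n (suc m) ∎
    where
    c d : ℕ → ℚ
    c n = g (ℕ.pred n) m
    d n = g (ℕ.pred n) (suc (suc m))

    last : ∀ n → ι (+ n) ℚ.* (ι (+ suc m) ℚ.* (c n ℚ.- d n)) ≡ ι (+ n) ℚ.* g n (suc m)
    last zero    = trans
      (ℚ.*-zeroˡ (ι (+ suc m) ℚ.* (c 0 ℚ.- d 0))) (sym (ℚ.*-zeroˡ (g 0 (suc m))))
    last (suc n) = cong (ι (+ suc n) ℚ.*_) (sym (g-suc n m))

-- The Stirling number expansion

S-vanish : ∀ {n j} → n < j → S n j ≡ 0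
S-vanish {zero}  {suc j} _         = refl
S-vanish {suc n} {suc j} (s≤s n<j)
  rewrite S-vanish {n} {suc j} (ℕ.m<n⇒m<1+n n<j) | S-vanish {n} {j} n<j =
  trans (ℕ.+-identityʳ (j ℕ.* 0)) (ℕ.*-zeroʳ j)

-- n! [tⁿ] wʲ with w = (e²ᵗ - 1)/2
W : ℕ → ℕ → ℕ
W n j = 2 ^ (n ∸ j) ℕ.* j ! ℕ.* S n j

W-vanish : ∀ {n j} → n < j → W n j ≡ 0
W-vanish {n} {j} n<j =
  trans (cong (2 ^ (n ∸ j) ℕ.* j ! ℕ.*_) (S-vanish n<j)) (ℕ.*-zeroʳ (2 ^ (n ∸ j) ℕ.* j !))

W-suc-zero : ∀ n → W (suc n) 0 ≡ 0
W-suc-zero n = ℕ.*-zeroʳ (2 ^ suc n ℕ.* 1)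

-- Since w′ = 1 + 2w, the derivative of wʲ⁺¹ is (j+1)(wʲ + 2wʲ⁺¹). The exponent `n ∸ j` exceeds
-- `n ∸ suc j` by one only for j < n; otherwise S(n,j+1) = 0 makes the affected term vanish.
W-suc : ∀ n j → W (suc n) (suc j) ≡ suc j ℕ.* (W n j ℕ.+ 2 ℕ.* W n (suc j))
W-suc n j with j ℕ.<? n
... | yes j<n rewrite ℕ.+-∸-assoc 1 j<n =
  lemma (2 ^ (n ∸ suc j)) (suc j) (j !) (S n (suc j)) (S n j)
  where
  lemma : ∀ p k f s t → 2 ℕ.* p ℕ.* (k ℕ.* f) ℕ.* (k ℕ.* s ℕ.+ t) ≡
    k ℕ.* (2 ℕ.* p ℕ.* f ℕ.* t ℕ.+ 2 ℕ.* (p ℕ.* (k ℕ.* f) ℕ.* s))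
  lemma = solveℕ-∀
... | no j≮n rewrite S-vanish {n} {suc j} (s≤s (ℕ.≮⇒≥ j≮n)) =
  lemma (2 ^ (n ∸ j)) (2 ^ (n ∸ suc j)) (suc j) (j !) (S n j)
  where
  lemma : ∀ p q k f t → p ℕ.* (k ℕ.* f) ℕ.* (k ℕ.* 0 ℕ.+ t) ≡
    k ℕ.* (p ℕ.* f ℕ.* t ℕ.+ 2 ℕ.* (q ℕ.* (k ℕ.* f) ℕ.* 0))
  lemma = solveℕ-∀

-- [wʲ] uⁱ with u = w/(1+w); the recursion is u (1+w) = w.
a : ℕ → ℕ → ℤ
a zero    zero    = 1ℤ
a zero    (suc j) = 0ℤ
a (suc i) zero    = 0ℤ
a (suc i) (suc j) = a i j ℤ.- a (suc i) j

a-vanish : ∀ {i j} → j < i → a i j ≡ 0ℤ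
a-vanish {suc i} {zero}  _         = refl
a-vanish {suc i} {suc j} (s≤s j<i)
  rewrite a-vanish j<i | a-vanish {suc i} {j} (ℕ.m<n⇒m<1+n j<i) = refl

-- The binomial series of wⁱ⁺¹ (1+w)⁻⁽ⁱ⁺¹⁾. Once the sign is split off, the recursion of `a` is
-- Pascal's rule.
a-closed : ∀ i d → a (suc i) (suc i ℕ.+ d) ≡ -1ℤ ℤ.^ d ℤ.* + ((i ℕ.+ d) C i)
a-closed zero    zero    = refl
a-closed (suc i) zero    = begin
  a (suc i) (suc i ℕ.+ 0) ℤ.- a (suc (suc i)) (suc i ℕ.+ 0)
    ≡⟨ cong₂ ℤ._-_ (a-closed i 0)
         (a-vanish {suc (suc i)} (s≤s (s≤s (ℕ.≤-reflexive (ℕ.+-identityʳ i))))) ⟩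
  1ℤ ℤ.* + ((i ℕ.+ 0) C i) ℤ.- 0ℤ
    ≡⟨ cong (λ t → 1ℤ ℤ.* + t ℤ.- 0ℤ) (diagonal i) ⟩
  1ℤ
    ≡⟨ cong (λ t → 1ℤ ℤ.* + t) (diagonal (suc i)) ⟨
  1ℤ ℤ.* + ((suc i ℕ.+ 0) C suc i) ∎
  where
  diagonal : ∀ k → (k ℕ.+ 0) C k ≡ 1
  diagonal k = trans (cong (_C k) (ℕ.+-identityʳ k)) (nCn≡1 k)
a-closed zero    (suc d) = begin
  0ℤ ℤ.- a 1 (suc d)               ≡⟨ cong (λ t → 0ℤ ℤ.- t) (a-closed 0 d) ⟩
  0ℤ ℤ.- -1ℤ ℤ.^ d ℤ.* 1ℤ          ≡⟨ lemma (-1ℤ ℤ.^ d) ⟩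
  -1ℤ ℤ.* -1ℤ ℤ.^ d ℤ.* 1ℤ         ∎
  where
  lemma : ∀ s → 0ℤ ℤ.- s ℤ.* 1ℤ ≡ -1ℤ ℤ.* s ℤ.* 1ℤ
  lemma = solveℤ-∀
a-closed (suc i) (suc d) = begin
  a (suc i) (suc i ℕ.+ suc d) ℤ.- a (suc (suc i)) (suc i ℕ.+ suc d)
    ≡⟨ cong₂ ℤ._-_ (a-closed i (suc d))
         (trans (cong (a (suc (suc i))) (ℕ.+-suc (suc i) d)) (a-closed (suc i) d)) ⟩
  -1ℤ ℤ.* s ℤ.* + p ℤ.- s ℤ.* + q
    ≡⟨ lemma s (+ p) (+ q) ⟩
  -1ℤ ℤ.* s ℤ.* (+ p ℤ.+ + q)
    ≡⟨ cong (λ t → -1ℤ ℤ.* s ℤ.* + t) pascal ⟩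
  -1ℤ ℤ.* s ℤ.* + ((suc i ℕ.+ suc d) C suc i) ∎
  where
  s = -1ℤ ℤ.^ d
  p = (i ℕ.+ suc d) C i
  q = (suc i ℕ.+ d) C suc i

  lemma : ∀ s p q → -1ℤ ℤ.* s ℤ.* p ℤ.- s ℤ.* q ≡ -1ℤ ℤ.* s ℤ.* (p ℤ.+ q)
  lemma = solveℤ-∀

  pascal : p ℕ.+ q ≡ (suc i ℕ.+ suc d) C suc i
  pascal = trans (cong (λ t → p ℕ.+ t C suc i) (sym (ℕ.+-suc i d)))
    (nCk+nC[k+1]≡[n+1]C[k+1] (i ℕ.+ suc d) i)

-- i (1 - u) uⁱ = w (d/dw) uⁱ
a-index : ∀ i j → (+ j ℤ.- + i) ℤ.* a i j ℤ.+ + i ℤ.* a (suc i) j ≡ 0ℤ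
a-index zero    zero    = refl
a-index zero    (suc j) = trans (ℤ.+-identityʳ _) (ℤ.*-zeroʳ (+ suc j ℤ.- + 0))
a-index (suc i) zero    = cong₂ ℤ._+_ (ℤ.*-zeroʳ (+ 0 ℤ.- + suc i)) (ℤ.*-zeroʳ (+ suc i))
a-index (suc i) (suc j) = begin
  (+ suc j ℤ.- + suc i) ℤ.* (a i j ℤ.- a (suc i) j) ℤ.+
    + suc i ℤ.* (a (suc i) j ℤ.- a (suc (suc i)) j)
    ≡⟨ lemma (+ i) (+ j) (a i j) (a (suc i) j) (a (suc (suc i)) j) ⟩
  ((+ j ℤ.- + i) ℤ.* a i j ℤ.+ + i ℤ.* a (suc i) j) ℤ.-
    ((+ j ℤ.- + suc i) ℤ.* a (suc i) j ℤ.+ + suc i ℤ.* a (suc (suc i)) j)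
    ≡⟨ cong₂ ℤ._-_ (a-index i j) (a-index (suc i) j) ⟩
  0ℤ ∎
  where
  lemma : ∀ i j p q r →
    ((1ℤ ℤ.+ j) ℤ.- (1ℤ ℤ.+ i)) ℤ.* (p ℤ.- q) ℤ.+ (1ℤ ℤ.+ i) ℤ.* (q ℤ.- r) ≡
    ((j ℤ.- i) ℤ.* p ℤ.+ i ℤ.* q) ℤ.- ((j ℤ.- (1ℤ ℤ.+ i)) ℤ.* q ℤ.+ (1ℤ ℤ.+ i) ℤ.* r)
  lemma = solveℤ-∀

-- (1+2w) (d/dw) uⁱ⁺¹ = (i+1) (1 - u²) uⁱ
a-derivative : ∀ i j →
  + suc j ℤ.* a (suc i) (suc j) ℤ.+ + 2 ℤ.* + j ℤ.* a (suc i) j ≡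
  + suc i ℤ.* (a i j ℤ.- a (suc (suc i)) j)
a-derivative i j = begin
  + suc j ℤ.* (a i j ℤ.- a (suc i) j) ℤ.+ + 2 ℤ.* + j ℤ.* a (suc i) j
    ≡⟨ lemma (+ i) (+ j) (a i j) (a (suc i) j) (a (suc (suc i)) j) ⟩
  + suc i ℤ.* (a i j ℤ.- a (suc (suc i)) j) ℤ.+
    (((+ j ℤ.- + i) ℤ.* a i j ℤ.+ + i ℤ.* a (suc i) j) ℤ.+
    ((+ j ℤ.- + suc i) ℤ.* a (suc i) j ℤ.+ + suc i ℤ.* a (suc (suc i)) j))
    ≡⟨ cong (λ t → + suc i ℤ.* (a i j ℤ.- a (suc (suc i)) j) ℤ.+ t)
         (cong₂ ℤ._+_ (a-index i j) (a-index (suc i) j)) ⟩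
  + suc i ℤ.* (a i j ℤ.- a (suc (suc i)) j) ℤ.+ 0ℤ
    ≡⟨ ℤ.+-identityʳ _ ⟩
  + suc i ℤ.* (a i j ℤ.- a (suc (suc i)) j) ∎
  where
  lemma : ∀ i j p q r →
    (1ℤ ℤ.+ j) ℤ.* (p ℤ.- q) ℤ.+ + 2 ℤ.* j ℤ.* q ≡
    (1ℤ ℤ.+ i) ℤ.* (p ℤ.- r) ℤ.+
      (((j ℤ.- i) ℤ.* p ℤ.+ i ℤ.* q) ℤ.+ ((j ℤ.- (1ℤ ℤ.+ i)) ℤ.* q ℤ.+ (1ℤ ℤ.+ i) ℤ.* r))
  lemma = solveℤ-∀

-- Composition of series: tanhⁱ t = Σ a(i,j) wʲ. The induction on n differentiates in t, where d/dt
-- = (1+2w) d/dw yields the recurrence of `G`. Any B > n is allowed because W(n,j) = 0 for j > n.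
∑aW≡G : ∀ n i B → n < B → ∑ℤ B (λ j → a i j ℤ.* + W n j) ≡ G n i
∑aW≡G zero i (suc B) _ = trans
  (cong (λ t → a i 0 ℤ.* 1ℤ ℤ.+ t) (∑ℤ-zero B λ j _ →
    trans (cong (λ t → a i (suc j) ℤ.* + t) (W-vanish {0} {suc j} (s≤s z≤n)))
      (ℤ.*-zeroʳ (a i (suc j)))))
  (head i)
  where
  head : ∀ i → a i 0 ℤ.* 1ℤ ℤ.+ 0ℤ ≡ G 0 i
  head zero    = refl
  head (suc i) = refl
∑aW≡G (suc n) zero (suc B) _ = cong₂ ℤ._+_
  (cong (λ t → 1ℤ ℤ.* + t) (W-suc-zero n)) (∑ℤ-zero B λ j _ → refl)
∑aW≡G (suc n) (suc i) (suc B) (s≤s n<B) = begin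
  0ℤ ℤ.* + W (suc n) 0 ℤ.+ ∑ℤ B (λ j → a (suc i) (suc j) ℤ.* + W (suc n) (suc j))
    ≡⟨ cong (λ t → 0ℤ ℤ.+ t) (∑ℤ-cong B λ j _ → split j) ⟩
  0ℤ ℤ.+ ∑ℤ B (λ j → u j ℤ.+ v (suc j))
    ≡⟨ ℤ.+-identityˡ _ ⟩
  ∑ℤ B (λ j → u j ℤ.+ v (suc j))
    ≡⟨ ℤS.∑-distrib-+ {B} (u ∘ toℕ) _ ⟩
  ∑ℤ B u ℤ.+ ∑ℤ B (λ j → v (suc j))
    -- Reindexing collects the coefficient of W(n,j). Both boundary terms vanish: `v 0` by its
    -- factor j = 0, and `v B` because n < B.
    ≡⟨ cong (λ t → ∑ℤ B u ℤ.+ t) shift ⟩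
  ∑ℤ B u ℤ.+ ∑ℤ B v
    ≡⟨ ℤS.∑-distrib-+ {B} (u ∘ toℕ) _ ⟨
  ∑ℤ B (λ j → u j ℤ.+ v j)
    ≡⟨ ∑ℤ-cong B (λ j _ → recombine j) ⟩
  ∑ℤ B (λ j → + suc i ℤ.* (a i j ℤ.* + W n j ℤ.+ -1ℤ ℤ.* (a (suc (suc i)) j ℤ.* + W n j)))
    ≡⟨ ℤS.*-distribˡ-sum {B} (+ suc i) _ ⟨
  + suc i ℤ.* ∑ℤ B (λ j → a i j ℤ.* + W n j ℤ.+ -1ℤ ℤ.* (a (suc (suc i)) j ℤ.* + W n j))
    ≡⟨ cong (+ suc i ℤ.*_) (trans (ℤS.∑-distrib-+ {B} _ _)
         (cong₂ ℤ._+_ (∑aW≡G n i B n<B) (trans (sym (ℤS.*-distribˡ-sum {B} -1ℤ _))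
           (trans (cong (-1ℤ ℤ.*_) (∑aW≡G n (suc (suc i)) B n<B)) (ℤ.-1*i≡-i _))))) ⟩
  + suc i ℤ.* (G n i ℤ.- G n (suc (suc i))) ∎
  where
  u v : ℕ → ℤ
  u j = + suc j ℤ.* a (suc i) (suc j) ℤ.* + W n j
  v j = + 2 ℤ.* + j ℤ.* a (suc i) j ℤ.* + W n j

  split : ∀ j → a (suc i) (suc j) ℤ.* + W (suc n) (suc j) ≡ u j ℤ.+ v (suc j)
  split j = begin
    a (suc i) (suc j) ℤ.* + W (suc n) (suc j)
      ≡⟨ cong (a (suc i) (suc j) ℤ.*_) (trans (cong +_ (W-suc n j))
           (trans (ℤ.pos-* (suc j) (W n j ℕ.+ 2 ℕ.* W n (suc j)))
             (cong (λ t → + suc j ℤ.* (+ W n j ℤ.+ t)) (ℤ.pos-* 2 (W n (suc j)))))) ⟩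
    a (suc i) (suc j) ℤ.* (+ suc j ℤ.* (+ W n j ℤ.+ + 2 ℤ.* + W n (suc j)))
      ≡⟨ lemma (a (suc i) (suc j)) (+ suc j) (+ W n j) (+ W n (suc j)) ⟩
    u j ℤ.+ v (suc j) ∎
    where
    lemma : ∀ c k w w′ → c ℤ.* (k ℤ.* (w ℤ.+ + 2 ℤ.* w′)) ≡
      k ℤ.* c ℤ.* w ℤ.+ + 2 ℤ.* k ℤ.* c ℤ.* w′
    lemma = solveℤ-∀

  v-end : v B ≡ 0ℤ
  v-end = trans (cong (λ t → + 2 ℤ.* + B ℤ.* a (suc i) B ℤ.* + t) (W-vanish n<B))
    (ℤ.*-zeroʳ (+ 2 ℤ.* + B ℤ.* a (suc i) B))

  shift : ∑ℤ B (λ j → v (suc j)) ≡ ∑ℤ B v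
  shift = begin
    ∑ℤ B (λ j → v (suc j))         ≡⟨ ℤ.+-identityˡ _ ⟨
    v 0 ℤ.+ ∑ℤ B (λ j → v (suc j)) ≡⟨ ∑ℤ-shift B v ⟩
    ∑ℤ B v ℤ.+ v B                 ≡⟨ cong (λ t → ∑ℤ B v ℤ.+ t) v-end ⟩
    ∑ℤ B v ℤ.+ 0ℤ                  ≡⟨ ℤ.+-identityʳ _ ⟩
    ∑ℤ B v                         ∎

  recombine : ∀ j → u j ℤ.+ v j ≡
    + suc i ℤ.* (a i j ℤ.* + W n j ℤ.+ -1ℤ ℤ.* (a (suc (suc i)) j ℤ.* + W n j))
  recombine j = begin
    u j ℤ.+ v j
      ≡⟨ ℤ.*-distribʳ-+ (+ W n j) (+ suc j ℤ.* a (suc i) (suc j)) (+ 2 ℤ.* + j ℤ.* a (suc i) j) ⟨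
    (+ suc j ℤ.* a (suc i) (suc j) ℤ.+ + 2 ℤ.* + j ℤ.* a (suc i) j) ℤ.* + W n j
      ≡⟨ cong (ℤ._* + W n j) (a-derivative i j) ⟩
    + suc i ℤ.* (a i j ℤ.- a (suc (suc i)) j) ℤ.* + W n j
      ≡⟨ lemma (+ suc i) (a i j) (a (suc (suc i)) j) (+ W n j) ⟩
    + suc i ℤ.* (a i j ℤ.* + W n j ℤ.+ -1ℤ ℤ.* (a (suc (suc i)) j ℤ.* + W n j)) ∎
    where
    lemma : ∀ k p r w → k ℤ.* (p ℤ.- r) ℤ.* w ≡ k ℤ.* (p ℤ.* w ℤ.+ -1ℤ ℤ.* (r ℤ.* w))
    lemma = solveℤ-∀

-- Each summand is a(i,j) W(n,j), and the terms with j < i are zero, so the sum may start at 0. For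
-- i ≥ 1 the truncated differences `i ∸ 1` and `j ∸ 1` are true predecessors.
closed-form : ∀ n i → 1 ≤ i →
  ∑[ j from i to n ] (((-1ℤ ℤ.^ (j ∸ i)) ℤ.* ℤ.+ (2 ^ (n ∸ j) ℕ.* j ! ℕ.* S n j ℕ.* ((j ∸ 1) C (i ∸ 1)))) ℚ./ 1)
  ≡ g n i
closed-form n (suc i) _ = begin
  ∑ℚ (suc n ∸ suc i) (λ d → ι (-1ℤ ℤ.^ (suc i ℕ.+ d ∸ suc i) ℤ.*
    + (W n (suc i ℕ.+ d) ℕ.* ((i ℕ.+ d) C i))))
    ≡⟨ ∑ℚ-cong (suc n ∸ suc i) (λ d _ → cong ι (term d)) ⟩
  ∑ℚ (suc n ∸ suc i) (λ d → ι (h (suc i ℕ.+ d)))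
    ≡⟨ ι-∑ (suc n ∸ suc i) (λ d → h (suc i ℕ.+ d)) ⟨
  ι (∑ℤ (suc n ∸ suc i) (λ d → h (suc i ℕ.+ d)))
    ≡⟨ cong ι (∑ℤ-drop (suc i) (suc n) λ j j<i → cong (ℤ._* + W n j) (a-vanish j<i)) ⟨
  ι (∑ℤ (suc n) h)
    ≡⟨ cong ι (∑aW≡G n (suc i) (suc n) ℕ.≤-refl) ⟩
  g n (suc i) ∎
  where
  h : ℕ → ℤ
  h j = a (suc i) j ℤ.* + W n j

  lemma : ∀ s w c → s ℤ.* (w ℤ.* c) ≡ s ℤ.* c ℤ.* w
  lemma = solveℤ-∀

  term : ∀ d → -1ℤ ℤ.^ (suc i ℕ.+ d ∸ suc i) ℤ.* + (W n (suc i ℕ.+ d) ℕ.* ((i ℕ.+ d) C i)) ≡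
    h (suc i ℕ.+ d)
  term d = begin
    -1ℤ ℤ.^ (suc i ℕ.+ d ∸ suc i) ℤ.* + (w ℕ.* c)
      ≡⟨ cong₂ (λ e t → -1ℤ ℤ.^ e ℤ.* t) (ℕ.m+n∸m≡n (suc i) d) (ℤ.pos-* w c) ⟩
    -1ℤ ℤ.^ d ℤ.* (+ w ℤ.* + c)
      ≡⟨ lemma (-1ℤ ℤ.^ d) (+ w) (+ c) ⟩
    -1ℤ ℤ.^ d ℤ.* + c ℤ.* + w
      ≡⟨ cong (ℤ._* + w) (a-closed i d) ⟨
    h (suc i ℕ.+ d) ∎
    where
    w = W n (suc i ℕ.+ d)
    c = (i ℕ.+ d) C i

-- Coefficient extraction by evaluation at coordinate points

-- Back substitution: equation m involves only the unknowns from m on, and its leading coefficient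
-- κ(1) evaluates to 1. The later unknowns agree by induction and cancel.
triangular-unique : ∀ n (f h : ℕ → ℚ) →
  (∀ m → m < n → ∑ℚ (n ∸ m) (λ k → f (m ℕ.+ k) ℚ.* κ (suc k)) ≡
                 ∑ℚ (n ∸ m) (λ k → h (m ℕ.+ k) ℚ.* κ (suc k))) →
  ∀ k → k < n → f k ≡ h k
triangular-unique (suc n) f h eq (suc k) (s≤s k<n) =
  triangular-unique n (f ∘ suc) (h ∘ suc) (λ m m<n → eq (suc m) (s≤s m<n)) k k<n
triangular-unique (suc n) f h eq zero _ = begin
  f 0        ≡⟨ ℚ.*-identityʳ (f 0) ⟨
  f 0 ℚ.* 1ℚ ≡⟨ ∙-cancelʳ tail (f 0 ℚ.* 1ℚ) (h 0 ℚ.* 1ℚ)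
                  (trans (cong (λ t → f 0 ℚ.* 1ℚ ℚ.+ t) (sym tails)) (eq 0 (s≤s z≤n))) ⟩
  h 0 ℚ.* 1ℚ ≡⟨ ℚ.*-identityʳ (h 0) ⟩
  h 0        ∎
  where
  open GroupProperties ℚ.+-0-group using (∙-cancelʳ)

  tail : ℚ
  tail = ∑ℚ n (λ k → h (suc k) ℚ.* κ (suc (suc k)))

  tails : ∑ℚ n (λ k → f (suc k) ℚ.* κ (suc (suc k))) ≡ tail
  tails = ∑ℚ-cong n λ k k<n → cong (ℚ._* κ (suc (suc k)))
    (triangular-unique n (f ∘ suc) (h ∘ suc) (λ m m<n → eq (suc m) (s≤s m<n)) k k<n)

-- The Kronecker delta, recursive so that a common shift of both arguments is definitional.
indicator : ℕ → ℕ → ℚ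
indicator zero    zero    = 1ℚ
indicator zero    (suc n) = 0ℚ
indicator (suc m) zero    = 0ℚ
indicator (suc m) (suc n) = indicator m n

∑-indicator : ∀ n m (f : ℕ → ℚ) → m < n → ∑ℚ n (λ k → f k ℚ.* indicator m k) ≡ f m
∑-indicator (suc n) zero    f _         = trans
  (cong₂ ℚ._+_ (ℚ.*-identityʳ (f 0)) (∑ℚ-zero n λ k _ → ℚ.*-zeroʳ (f (suc k))))
  (ℚ.+-identityʳ (f 0))
∑-indicator (suc n) (suc m) f (s≤s m<n) = trans
  (cong₂ ℚ._+_ (ℚ.*-zeroʳ (f 0)) (∑-indicator n m (f ∘ suc) m<n))
  (ℚ.+-identityˡ (f (suc m)))

∑-indicator-vanish : ∀ n m (f : ℕ → ℚ) → n ≤ m → ∑ℚ n (λ k → f k ℚ.* indicator m k) ≡ 0ℚ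
∑-indicator-vanish zero    m       f _         = refl
∑-indicator-vanish (suc n) (suc m) f (s≤s n≤m) = trans
  (cong₂ ℚ._+_ (ℚ.*-zeroʳ (f 0)) (∑-indicator-vanish n m (f ∘ suc) n≤m))
  (ℚ.+-identityˡ 0ℚ)

-- Combined with truncated subtraction, `shifted f (n ∸ m)` is f(n-m-1) for m < n and 0 otherwise,
-- without a case distinction.
shifted : (ℕ → ℚ) → ℕ → ℚ
shifted f zero    = 0ℚ
shifted f (suc n) = f n

-- Only j = n-m-1 contributes, and it lies in the range exactly when m < n.
∑-indicator-reverse : ∀ n m (f : ℕ → ℚ) →
  ∑ℚ n (λ j → f j ℚ.* indicator m (n ∸ suc j)) ≡ shifted f (n ∸ m)
∑-indicator-reverse zero    zero    f = refl
∑-indicator-reverse zero    (suc m) f = refl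
∑-indicator-reverse (suc n) m       f =
  trans (cong (λ t → f 0 ℚ.* indicator m n ℚ.+ t) (∑-indicator-reverse n m (f ∘ suc))) (step n m)
  where
  step : ∀ n m → f 0 ℚ.* indicator m n ℚ.+ shifted (f ∘ suc) (n ∸ m) ≡ shifted f (suc n ∸ m)
  step zero    zero    = trans (ℚ.+-identityʳ _) (ℚ.*-identityʳ (f 0))
  step (suc n) zero    = trans (cong (ℚ._+ f (suc n)) (ℚ.*-zeroʳ (f 0))) (ℚ.+-identityˡ _)
  step zero    (suc m) = trans (ℚ.+-identityʳ _) (trans (ℚ.*-zeroʳ (f 0)) (sym (lemma m)))
    where
    lemma : ∀ m → shifted f (0 ∸ m) ≡ 0ℚ
    lemma zero    = refl
    lemma (suc m) = refl
  step (suc n) (suc m) = step n m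

-- The m-th unit vector. The polynomials evaluated there are equivalent to linear forms, so
-- evaluation reads off the coefficient of x_m and respects `_≈_`.
coordinate : ∀ {N} → ℕ → Fin N → ℚ
coordinate m i = indicator m (toℕ i)

eval-x : ∀ {N} m n (n≤N : n ≤ N) → eval (coordinate m) (x n n≤N) ≡ indicator m n
eval-x m n n≤N = cong (indicator m) (toℕ-fromℕ< (s≤s n≤N))

eval-∑ : ∀ {M} (ρ : Fin M → ℚ) n (c : ℕ → ℚ) (p : Fin n → Poly M) (h : ℕ → ℚ) →
  (∀ k → eval ρ (p k) ≡ h (toℕ k)) →
  eval ρ (∑[ k < n ] (c (toℕ k) • p k)) ≡ ∑ℚ n (λ k → c k ℚ.* h k)
eval-∑ ρ zero    c p h p≡h = refl
eval-∑ ρ (suc n) c p h p≡h = cong₂ ℚ._+_ (cong (c 0 ℚ.*_) (p≡h zero))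
  (eval-∑ ρ n (c ∘ suc) (p ∘ suc) (h ∘ suc) (p≡h ∘ suc))

eval-derive-∑ : ∀ {M} (ρ : Fin M → ℚ) (v : Fin M → Poly M) n (c : ℕ → ℚ)
  (p : Fin n → Poly M) (h : ℕ → ℚ) →
  (∀ k → eval ρ (derive v (p k)) ≡ h (toℕ k)) →
  eval ρ (derive v (∑[ k < n ] (c (toℕ k) • p k))) ≡ ∑ℚ n (λ k → c k ℚ.* h k)
eval-derive-∑ ρ v zero    c p h p≡h = refl
eval-derive-∑ ρ v (suc n) c p h p≡h = cong₂ ℚ._+_
  -- The Leibniz rule also produces the derivative of the constant, which is 0.
  (trans (cong₂ ℚ._+_ (ℚ.*-zeroˡ (eval ρ (p zero))) (cong (c 0 ℚ.*_) (p≡h zero)))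
    (ℚ.+-identityˡ (c 0 ℚ.* h 0)))
  (eval-derive-∑ ρ v n (c ∘ suc) (p ∘ suc) (h ∘ suc) (p≡h ∘ suc))

κ⁺ : ℕ → ℚ
κ⁺ j = κ (suc j)

eval-𝒦₁-x : ∀ {N} m n (n≤N : n ≤ N) →
  eval (coordinate m) (𝒦₁ N (x n n≤N)) ≡ shifted κ⁺ (n ∸ m)
eval-𝒦₁-x {N} m n n≤N = begin
  eval (coordinate m) (𝒦₁-values N i)
    ≡⟨ eval-∑ (coordinate m) (toℕ i) κ⁺ _ (λ j → indicator m (toℕ i ∸ suc j))
         (λ j → eval-x m (toℕ i ∸ suc (toℕ j))
           (≤-trans (ℕ.m∸n≤m (toℕ i) (suc (toℕ j))) (ℕ.s≤s⁻¹ (toℕ<n i)))) ⟩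
  ∑ℚ (toℕ i) (λ j → κ⁺ j ℚ.* indicator m (toℕ i ∸ suc j))
    ≡⟨ ∑-indicator-reverse (toℕ i) m κ⁺ ⟩
  shifted κ⁺ (toℕ i ∸ m)
    ≡⟨ cong (λ t → shifted κ⁺ (t ∸ m)) (toℕ-fromℕ< (s≤s n≤N)) ⟩
  shifted κ⁺ (n ∸ m) ∎
  where
  i : Fin (suc N)
  i = fromℕ< (s≤s n≤N)

-- `𝒟-xₙ` with natural indices; the two forms of the index agree only propositionally, hence the
-- `subst`.
𝒟-x : ∀ {N} n (n<N : n < N) →
  𝒟 N (x (suc n) n<N) ≈ ι (+ suc n) • x n (ℕ.<⇒≤ n<N)
𝒟-x {N} n n<N = subst (λ p → 𝒟 N (x (suc n) n<N) ≈ p)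
  (cong₂ (λ j i → ι (+ suc j) • var i) (toℕ-fromℕ< n<N)
    (toℕ-injective (trans (toℕ-inject₁ (fromℕ< n<N))
      (trans (toℕ-fromℕ< n<N) (sym (toℕ-fromℕ< (s≤s (ℕ.<⇒≤ n<N))))))))
  (𝒟-xₙ N (fromℕ< n<N))

-- The coefficients T(n,i) of the intertwining map.

module _ {N : ℕ} {ψ : Poly (suc N) → Poly (suc N)}
  (ψ-intertwining : IsIntertwining (𝒟 N) (𝒦₁ N) ψ) (T : ℕ → ℕ → ℚ)
  (ψ-x₀ : ψ (x 0 z≤n) ≈ x 0 z≤n)
  (ψ-xₙ : ∀ n → 1 ≤ n → (n≤N : n ≤ N) →
    ψ (x n n≤N) ≈
    ∑[ k < n ] (T n (suc (toℕ k)) • x (suc (toℕ k)) (≤-trans (toℕ<n k) n≤N)))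
  where
  open IsIntertwining ψ-intertwining
  open LeftModuleMorphisms.IsLeftModuleHomomorphism isLinear using (⟦⟧-cong; *ₗ-homo)

  positive-x : ∀ {n} → n ≤ N → Fin n → Poly (suc N)
  positive-x n≤N k = x (suc (toℕ k)) (≤-trans (toℕ<n k) n≤N)

  -- Both sides are the coefficient of x_m in the intertwining relation at x_{n+1}. The image of x_n
  -- stays unexpanded, which treats n = 0 and n > 0 uniformly.
  T-recurrence : ∀ n (n<N : n < N) m → m ≤ n →
    ∑ℚ (suc n ∸ m) (λ k → T (suc n) (suc (m ℕ.+ k)) ℚ.* κ (suc k)) ≡
    ι (+ suc n) ℚ.* eval (coordinate m) (ψ (x n (ℕ.<⇒≤ n<N)))
  T-recurrence n n<N m m≤n = begin
    ∑ℚ (suc n ∸ m) (λ k → T (suc n) (suc (m ℕ.+ k)) ℚ.* κ⁺ k)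
      ≡⟨ ∑ℚ-cong (suc n ∸ m) (λ k _ →
           cong (λ t → T (suc n) (suc (m ℕ.+ k)) ℚ.* shifted κ⁺ t) (suc[m+k]∸m k)) ⟨
    ∑ℚ (suc n ∸ m) (λ k → h (m ℕ.+ k))
      -- The variable x_m occurs in 𝒦₁ x_{k+1} only for k ≥ m.
      ≡⟨ ∑ℚ-drop m (suc n) (λ k k<m → trans
           (cong (λ t → T (suc n) (suc k) ℚ.* shifted κ⁺ t) (ℕ.m≤n⇒m∸n≡0 k<m))
           (ℚ.*-zeroʳ (T (suc n) (suc k)))) ⟨
    ∑ℚ (suc n) h
      ≡⟨ eval-derive-∑ ρ (𝒦₁-values N) (suc n) (T (suc n) ∘ suc) (positive-x n<N)
           (λ k → shifted κ⁺ (suc k ∸ m))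
           (λ k → eval-𝒦₁-x m (suc (toℕ k)) (≤-trans (toℕ<n k) n<N)) ⟨
    eval ρ (𝒦₁ N (∑[ k < suc n ] (T (suc n) (suc (toℕ k)) • positive-x n<N k)))
      ≡⟨ eval-cong ρ (derive-cong (𝒦₁-values N) (ψ-xₙ (suc n) (s≤s z≤n) n<N)) ⟨
    eval ρ (𝒦₁ N (ψ (x (suc n) n<N)))
      ≡⟨ eval-cong ρ (intertwine (x (suc n) n<N)) ⟨
    eval ρ (ψ (𝒟 N (x (suc n) n<N)))
      ≡⟨ eval-cong ρ (⟦⟧-cong (𝒟-x n n<N)) ⟩
    eval ρ (ψ (ι (+ suc n) • x n (ℕ.<⇒≤ n<N)))
      ≡⟨ eval-cong ρ (*ₗ-homo (ι (+ suc n)) (x n (ℕ.<⇒≤ n<N))) ⟩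
    ι (+ suc n) ℚ.* eval ρ (ψ (x n (ℕ.<⇒≤ n<N))) ∎
    where
    ρ : Fin (suc N) → ℚ
    ρ = coordinate m

    h : ℕ → ℚ
    h k = T (suc n) (suc k) ℚ.* shifted κ⁺ (suc k ∸ m)

    suc[m+k]∸m : ∀ k → suc (m ℕ.+ k) ∸ m ≡ suc k
    suc[m+k]∸m k = trans (cong (_∸ m) (sym (ℕ.+-suc m k))) (ℕ.m+n∸m≡n m (suc k))

  mutual
    -- Row n+1 of T solves a triangular system whose right-hand side consists of the coefficients of
    -- ψ x_n; by `g-κ` the numbers g solve the same system. The two mutual statements alternate
    -- along n.
    T≡g : ∀ n → n < N → ∀ i → i < suc n → T (suc n) (suc i) ≡ g (suc n) (suc i)
    T≡g n n<N = triangular-unique (suc n) (T (suc n) ∘ suc) (g (suc n) ∘ suc) λ m m<1+n →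
      trans (T-recurrence n n<N m (ℕ.s≤s⁻¹ m<1+n))
      (trans (cong (ι (+ suc n) ℚ.*_) (eval-ψ-x n (ℕ.<⇒≤ n<N) m))
        (sym (g-κ (suc n) m (suc n ∸ m) (ℕ.m≤n+m∸n (suc n) m))))

    eval-ψ-x : ∀ n (n≤N : n ≤ N) m → eval (coordinate m) (ψ (x n n≤N)) ≡ g n m
    eval-ψ-x zero    _   m = trans (eval-cong (coordinate m) ψ-x₀) (indicator≡g m)
      where
      indicator≡g : ∀ m → indicator m 0 ≡ g 0 m
      indicator≡g zero    = refl
      indicator≡g (suc m) = refl
    eval-ψ-x (suc n) n<N m = begin
      eval (coordinate m) (ψ (x (suc n) n<N))
        ≡⟨ eval-cong (coordinate m) (ψ-xₙ (suc n) (s≤s z≤n) n<N) ⟩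
      eval (coordinate m) (∑[ k < suc n ] (T (suc n) (suc (toℕ k)) • positive-x n<N k))
        ≡⟨ eval-∑ (coordinate m) (suc n) (T (suc n) ∘ suc) (positive-x n<N) (indicator m ∘ suc)
             (λ k → eval-x m (suc (toℕ k)) (≤-trans (toℕ<n k) n<N)) ⟩
      ∑ℚ (suc n) (λ k → T (suc n) (suc k) ℚ.* indicator m (suc k))
        ≡⟨ ∑ℚ-cong (suc n) (λ k k<1+n → cong (ℚ._* indicator m (suc k)) (T≡g n n<N k k<1+n)) ⟩
      ∑ℚ (suc n) (λ k → g (suc n) (suc k) ℚ.* indicator m (suc k))
        ≡⟨ pick m ⟩
      g (suc n) m ∎
      where
      pick : ∀ m → ∑ℚ (suc n) (λ k → g (suc n) (suc k) ℚ.* indicator m (suc k)) ≡ g (suc n) m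
      -- The given form of ψ x_{n+1} has no x_0 term, in accordance with G(n+1,0) = 0.
      pick zero = ∑ℚ-zero (suc n) λ k _ → ℚ.*-zeroʳ (g (suc n) (suc k))
      pick (suc m) with m ℕ.<? suc n
      ... | yes m<1+n = ∑-indicator (suc n) m (g (suc n) ∘ suc) m<1+n
      ... | no  m≮1+n = trans
        (∑-indicator-vanish (suc n) m (g (suc n) ∘ suc) (ℕ.≮⇒≥ m≮1+n))
        (sym (cong ι (G-vanish (s≤s (ℕ.≮⇒≥ m≮1+n)))))

theorem3p1 : (N : ℕ) → 1 ≤ N →
    (ψ : Poly (suc N) → Poly (suc N)) → IsIntertwining (𝒟 N) (𝒦₁ N) ψ →
    (T : ℕ → ℕ → ℚ) →
    ψ (x 0 z≤n) ≈ x 0 z≤n →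
    (∀ n → 1 ≤ n → (n≤N : n ≤ N) →
    ψ (x n n≤N) ≈
    ∑[ k < n ] (T n (suc (toℕ k)) • x (suc (toℕ k)) (≤-trans (toℕ<n k) n≤N))) →
    ∀ n i → 1 ≤ i → i ≤ n → n ≤ N →
    T n i ≡
    ∑[ j from i to n ] (((-1ℤ ℤ.^ (j ∸ i)) ℤ.* ℤ.+ (2 ^ (n ∸ j) ℕ.* j ! ℕ.* S n j ℕ.* ((j ∸ 1) C (i ∸ 1)))) ℚ./ 1)
theorem3p1 N _ ψ ψ-intertwining T ψ-x₀ ψ-xₙ (suc n) (suc i) 1≤i i<1+n n<N = trans
  (T≡g ψ-intertwining T ψ-x₀ ψ-xₙ n n<N i i<1+n)
  (sym (closed-form (suc n) (suc i) 1≤i))
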